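{- Let $K$ be a field and $X$ a non-empty finite set. The free associative unitary algebra $\mathbb{A}_K(X)$ is $0$-interpretable in the free associative non-unitary algebra $\mathbb{A}^0_K(X)$, uniformly in $K$ and $|X|$.
   Context: $\mathbb{A}_K(X)$ is the free associative algebra with unity over $K$ with basis $X$, in the language $\{+,\cdot,0,1\}$; $\mathbb{A}^0_K(X)$ is the free associative algebra without unity over $K$ with basis $X$, in the language $\{+,\cdot,0\}$. $\mathbb{A}$ is $0$-interpretable in $\mathbb{B}$ if there are a subset $A^*\subseteq B^m$ and an equivalence relation $\sim$ on $A^*$ definable in $\mathbb{B}$ without parameters, together with operations/constants on $A^*/\sim$ whose preimages are definable without parameters, making $A^*/\sim$ isomorphic to $\mathbb{A}$. Uniformly in $K$ and $|X|$ means the interpreting formulas are the same for all fields $K$ and all $X$ of a given cardinality. -}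

module Defs where

open import Level using (Level; _⊔_; Setω)
open import Data.Nat using (ℕ; suc) renaming (_+_ to _+ℕ_)
open import Data.Fin using (Fin)
import Data.Fin.Properties as FinP
open import Data.List using (List; []; _∷_; _++_)
import Data.List.Properties as ListP
open import Data.Product using (Σ; _×_; _,_; ∃)
import Data.Product.Properties as ProdP
open import Data.Sum using (_⊎_)
open import Data.Empty using (⊥)
open import Relation.Nullary using (¬_; yes; no)
open import Relation.Binary using (DecidableEquality)
open import Relation.Binary.PropositionalEquality using (_≡_)
open import Algebra.Bundles using (CommutativeRing)
open import Function.Bundles using (_⇔_)
import Data.Vec.Functional as VF

record Field (c ℓ : Level) : Set (Level.suc (c ⊔ ℓ)) where
  field
    commutativeRing : CommutativeRing c ℓ
  open CommutativeRing commutativeRing public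
  field
    0≉1      : ¬ (0# ≈ 1#)
    inverse  : ∀ x → ¬ (x ≈ 0#) → Σ Carrier (λ y → (x * y) ≈ 1#)

data Term (k : ℕ) : Set where
  var  : Fin k → Term k
  zro  : Term k
  _⊕_  : Term k → Term k → Term k
  _⊗_  : Term k → Term k → Term k

data Formula : ℕ → Set where
  _≐_  : ∀ {k} → Term k → Term k → Formula k
  ⊤ᶠ ⊥ᶠ : ∀ {k} → Formula k
  ¬ᶠ_  : ∀ {k} → Formula k → Formula k
  _∧ᶠ_ _∨ᶠ_ _⇒ᶠ_ : ∀ {k} → Formula k → Formula k → Formula k
  ∀ᶠ ∃ᶠ : ∀ {k} → Formula (suc k) → Formula k

record Struct⁰ (c ℓ : Level) : Set (Level.suc (c ⊔ ℓ)) where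
  field
    Carrier : Set c
    _≈_     : Carrier → Carrier → Set ℓ
    _+_ _·_ : Carrier → Carrier → Carrier
    0#      : Carrier

record Struct¹ (c ℓ : Level) : Set (Level.suc (c ⊔ ℓ)) where
  field
    Carrier : Set c
    _≈_     : Carrier → Carrier → Set ℓ
    _+_ _·_ : Carrier → Carrier → Carrier
    0# 1#   : Carrier

module _ {c ℓ} (M : Struct⁰ c ℓ) where
  open Struct⁰ M

  evalT : ∀ {k} → Term k → (Fin k → Carrier) → Carrier
  evalT (var i) ρ = ρ i
  evalT zro     ρ = 0#
  evalT (s ⊕ t) ρ = evalT s ρ + evalT t ρ
  evalT (s ⊗ t) ρ = evalT s ρ · evalT t ρ

  Sat : ∀ {k} → Formula k → (Fin k → Carrier) → Set (c ⊔ ℓ)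
  Sat (s ≐ t)   ρ = Level.Lift c (evalT s ρ ≈ evalT t ρ)
  Sat ⊤ᶠ        ρ = Level.Lift _ (⊥ → ⊥)
  Sat ⊥ᶠ        ρ = Level.Lift _ ⊥
  Sat (¬ᶠ φ)    ρ = ¬ Sat φ ρ
  Sat (φ ∧ᶠ ψ)  ρ = Sat φ ρ × Sat ψ ρ
  Sat (φ ∨ᶠ ψ)  ρ = Sat φ ρ ⊎ Sat ψ ρ
  Sat (φ ⇒ᶠ ψ)  ρ = Sat φ ρ → Sat ψ ρ
  Sat (∀ᶠ φ)    ρ = (a : Carrier) → Sat φ (a VF.∷ ρ)
  Sat (∃ᶠ φ)    ρ = Σ Carrier (λ a → Sat φ (a VF.∷ ρ))

record InterpData : Set where
  field
    dim   : ℕ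
    dom   : Formula dim
    eqv   : Formula (dim +ℕ dim)
    plus  : Formula (dim +ℕ (dim +ℕ dim))
    times : Formula (dim +ℕ (dim +ℕ dim))
    zeroF : Formula dim
    oneF  : Formula dim

-- The formulas I interpret A in B: there is a coordinate map
-- f : A* → A which is surjective, whose kernel is exactly ∼, and which
-- carries the defined relations onto the graphs of +, ·, 0, 1 of A.
-- (Equivalently, A*/∼ with the induced operations is isomorphic to A.)
record Interprets {c₁ ℓ₁ c₂ ℓ₂} (I : InterpData) (A : Struct¹ c₁ ℓ₁)
                  (B : Struct⁰ c₂ ℓ₂) : Set (c₁ ⊔ ℓ₁ ⊔ c₂ ⊔ ℓ₂) where
  open InterpData I
  private
    module A = Struct¹ A
    module B = Struct⁰ B
    Tup = Fin dim → B.Carrier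
    _⊨_ : ∀ {k} → Formula k → (Fin k → B.Carrier) → Set (c₂ ⊔ ℓ₂)
    φ ⊨ ρ = Sat B φ ρ
  field
    coord   : (a : Tup) → dom ⊨ a → A.Carrier
    surj    : ∀ x → Σ Tup (λ a → Σ (dom ⊨ a) (λ d → coord a d A.≈ x))
    kernel  : ∀ a b (da : dom ⊨ a) (db : dom ⊨ b) →
              (eqv ⊨ (a VF.++ b)) ⇔ (coord a da A.≈ coord b db)
    plus-ok : ∀ a b e (da : dom ⊨ a) (db : dom ⊨ b) (de : dom ⊨ e) →
              (plus ⊨ (a VF.++ (b VF.++ e))) ⇔
              ((coord a da A.+ coord b db) A.≈ coord e de)
    times-ok : ∀ a b e (da : dom ⊨ a) (db : dom ⊨ b) (de : dom ⊨ e) →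
              (times ⊨ (a VF.++ (b VF.++ e))) ⇔
              ((coord a da A.· coord b db) A.≈ coord e de)
    zero-ok : ∀ a (da : dom ⊨ a) → (zeroF ⊨ a) ⇔ (coord a da A.≈ A.0#)
    one-ok  : ∀ a (da : dom ⊨ a) → (oneF ⊨ a) ⇔ (coord a da A.≈ A.1#)

-- Free associative algebras over a field K with basis X = Fin n.
-- An element is a finite formal K-linear combination of words, given as
-- a list of (coefficient, word) pairs; two lists are equal iff every
-- word receives the same total coefficient.

module FreeAlg {c ℓ} (K : Field c ℓ) where
  open Field K renaming (Carrier to k; _+_ to _+ₖ_; _*_ to _*ₖ_)

  module Poly {W : Set} (_≟W_ : DecidableEquality W) (_∙W_ : W → W → W) where
    P : Set c
    P = List (k × W)

    coeff : P → W → k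
    coeff []            w = 0#
    coeff ((a , u) ∷ p) w with u ≟W w
    ... | yes _ = a +ₖ coeff p w
    ... | no  _ = coeff p w

    _≈P_ : P → P → Set ℓ
    p ≈P q = ∀ w → coeff p w ≈ coeff q w

    _+P_ : P → P → P
    _+P_ = _++_

    scaleMul : k × W → P → P
    scaleMul m []              = []
    scaleMul (a , u) ((b , v) ∷ q) = (a *ₖ b , u ∙W v) ∷ scaleMul (a , u) q

    _·P_ : P → P → P
    []      ·P q = []
    (m ∷ p) ·P q = scaleMul m q ++ (p ·P q)

  Word : ℕ → Set
  Word n = List (Fin n)

  -- Non-empty words (semigroup on X) — basis of A⁰_K(X): first letter + rest.
  Word⁺ : ℕ → Set
  Word⁺ n = Fin n × List (Fin n)

  _∙⁺_ : ∀ {n} → Word⁺ n → Word⁺ n → Word⁺ n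
  (x , u) ∙⁺ (y , v) = x , (u ++ (y ∷ v))

  𝔸 : ℕ → Struct¹ c ℓ
  𝔸 n = record
    { Carrier = P ; _≈_ = _≈P_ ; _+_ = _+P_ ; _·_ = _·P_
    ; 0# = [] ; 1# = (1# , []) ∷ [] }
    where open Poly {Word n} (ListP.≡-dec FinP._≟_) _++_

  𝔸⁰ : ℕ → Struct⁰ c ℓ
  𝔸⁰ n = record
    { Carrier = P ; _≈_ = _≈P_ ; _+_ = _+P_ ; _·_ = _·P_ ; 0# = [] }
    where open Poly {Word⁺ n} (ProdP.≡-dec FinP._≟_ (ListP.≡-dec FinP._≟_)) _∙⁺_

record UniformlyInterpretable (n : ℕ) : Setω where
  field
    formulas : InterpData
    works    : ∀ {c ℓ} (K : Field c ℓ) →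
               Interprets formulas (FreeAlg.𝔸 K n) (FreeAlg.𝔸⁰ K n)

{-# OPTIONS --safe #-}
-- An element f of the unital algebra is encoded by a pair (u , u f) with u left
-- cancellable.  That a lies in u 𝔸 is first-order over 𝔸⁰: it says that u divides
-- a z on the left for every z, and for z = x a generator the quotient f is
-- recovered by erasing the final letter x from b, where u b = a x (b has no
-- constant term).  Although f itself need not belong to 𝔸⁰, f z does, and it is
-- the unique c with u c = a z; all operations are read off from these elements.
module Submission where

open import Defs
open import Level using (_⊔_; lift; lower)
open import Data.Nat using (ℕ; suc; NonZero)
open import Data.Fin using (Fin; zero; suc)
open import Data.Fin.Patterns
import Data.Fin.Properties as FinP
open import Data.List using (List; []; _∷_; _++_; map; mapMaybe; cartesianProductWith)
import Data.List.Properties as ListP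
open import Data.List.Membership.Propositional using (_∈_)
open import Data.List.Membership.Propositional.Properties using (∈-map⁺; ∈-++⁺ˡ; ∈-++⁺ʳ)
open import Data.List.Relation.Unary.All using (All; []; _∷_)
import Data.List.Relation.Unary.All as All
open import Data.List.Relation.Unary.Any using (here; there)
open import Data.Maybe using (Maybe; just; nothing; maybe)
import Data.Maybe as Maybe
import Data.Maybe.Properties as MaybeP
open import Data.Product using (Σ; _×_; _,_; proj₁; proj₂)
import Data.Product.Properties as ProdP
open import Data.Sum using (_⊎_; inj₁; inj₂)
open import Function using (_∘_)
open import Function.Bundles using (_⇔_; mk⇔)
open import Relation.Binary using (DecidableEquality; Setoid)
open import Relation.Binary.PropositionalEquality as ≡ using (_≡_)
import Relation.Binary.Reasoning.Setoid as SetoidReasoning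
open import Relation.Nullary using (yes; no; contradiction)
import Data.Vec.Functional as VF

-- Formal sums tested by linear functionals, and their products.

module FormalSums {c ℓ} (K : Field c ℓ) where
  open Field K renaming (Carrier to k)
  open SetoidReasoning setoid

  Sum : Set → Set c
  Sum W = List (k × W)

  extend : ∀ {W} → Sum W → (W → k) → k
  extend []            φ = 0#
  extend ((a , u) ∷ p) φ = a * φ u + extend p φ

  infix 4 _≋_

  -- Testing against all linear functionals makes product and push respect equality
  -- without inspecting coefficients.
  -- A record rather than a bare Π-type, so that p and q can be inferred.
  record _≋_ {W : Set} (p q : Sum W) : Set (c ⊔ ℓ) where
    constructor mk≋
    field at : ∀ φ → extend p φ ≈ extend q φ
  open _≋_ public

  ≋-setoid : Set → Setoid c (c ⊔ ℓ)
  ≋-setoid W = record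
    { Carrier = Sum W
    ; _≈_ = _≋_
    ; isEquivalence = record
      { refl  = mk≋ λ _ → refl
      ; sym   = λ e → mk≋ λ φ → sym (at e φ)
      ; trans = λ e f → mk≋ λ φ → trans (at e φ) (at f φ)
      }
    }

  module ≋ {W} = Setoid (≋-setoid W)

  private
    variable
      U V W Z : Set

  interchange : ∀ a b c d → (a + b) + (c + d) ≈ (a + c) + (b + d)
  interchange a b c d = begin
    (a + b) + (c + d)  ≈⟨ +-assoc a b (c + d) ⟩
    a + (b + (c + d))  ≈⟨ +-congˡ (+-assoc b c d) ⟨
    a + ((b + c) + d)  ≈⟨ +-congˡ (+-congʳ (+-comm b c)) ⟩
    a + ((c + b) + d)  ≈⟨ +-congˡ (+-assoc c b d) ⟩
    a + (c + (b + d))  ≈⟨ +-assoc a c (b + d) ⟨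
    (a + c) + (b + d)  ∎

  extend-cong : (p : Sum W) {φ ψ : W → k} → (∀ w → φ w ≈ ψ w) → extend p φ ≈ extend p ψ
  extend-cong []            e = refl
  extend-cong ((a , u) ∷ p) e = +-cong (*-congˡ (e u)) (extend-cong p e)

  extend-++ : (p q : Sum W) (φ : W → k) → extend (p ++ q) φ ≈ extend p φ + extend q φ
  extend-++ []            q φ = sym (+-identityˡ _)
  extend-++ ((a , u) ∷ p) q φ =
    trans (+-congˡ (extend-++ p q φ)) (sym (+-assoc _ _ _))

  ++-cong : {p p′ q q′ : Sum W} → p ≋ p′ → q ≋ q′ → p ++ q ≋ p′ ++ q′
  ++-cong {p = p} {p′} {q} {q′} e f = mk≋ λ φ →
    trans (extend-++ p q φ) (trans (+-cong (at e φ) (at f φ)) (sym (extend-++ p′ q′ φ)))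

  bilinear : (U → V → W) → k × U → k × V → k × W
  bilinear _∙_ (a , u) (b , v) = a * b , u ∙ v

  -- Three basis types let one definition cover the multiplications of both algebras and the left
  -- and right actions of the unital one on the non-unital one.
  product : (U → V → W) → Sum U → Sum V → Sum W
  product _∙_ = cartesianProductWith (bilinear _∙_)

  extend-map-bilinear : (_∙_ : U → V → W) (a : k) (u : U) (q : Sum V) (φ : W → k) →
    extend (map (bilinear _∙_ (a , u)) q) φ ≈ a * extend q (λ v → φ (u ∙ v))
  extend-map-bilinear _∙_ a u []            φ = sym (zeroʳ a)
  extend-map-bilinear _∙_ a u ((b , v) ∷ q) φ =
    trans (+-cong (*-assoc a b _) (extend-map-bilinear _∙_ a u q φ)) (sym (distribˡ a _ _))

  -- Bilinearity turns a product under a functional into two nested sums; identities between words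
  -- thereby lift to identities between products.
  extend-product : (_∙_ : U → V → W) (p : Sum U) (q : Sum V) (φ : W → k) →
    extend (product _∙_ p q) φ ≈ extend p (λ u → extend q (λ v → φ (u ∙ v)))
  extend-product _∙_ []            q φ = refl
  extend-product _∙_ ((a , u) ∷ p) q φ =
    trans (extend-++ (map (bilinear _∙_ (a , u)) q) _ φ)
          (+-cong (extend-map-bilinear _∙_ a u q φ) (extend-product _∙_ p q φ))

  product-congˡ : (_∙_ : U → V → W) (p : Sum U) {q q′ : Sum V} →
    q ≋ q′ → product _∙_ p q ≋ product _∙_ p q′
  product-congˡ _∙_ p {q} {q′} e = mk≋ λ φ → begin
    extend (product _∙_ p q) φ                       ≈⟨ extend-product _∙_ p q φ ⟩
    extend p (λ u → extend q (λ v → φ (u ∙ v)))      ≈⟨ extend-cong p (λ _ → at e _) ⟩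
    extend p (λ u → extend q′ (λ v → φ (u ∙ v)))     ≈⟨ extend-product _∙_ p q′ φ ⟨
    extend (product _∙_ p q′) φ                      ∎

  product-congʳ : (_∙_ : U → V → W) (q : Sum V) {p p′ : Sum U} →
    p ≋ p′ → product _∙_ p q ≋ product _∙_ p′ q
  product-congʳ _∙_ q {p} {p′} e = mk≋ λ φ → begin
    extend (product _∙_ p q) φ                       ≈⟨ extend-product _∙_ p q φ ⟩
    -- The inner sum is a function of `u` alone, hence itself a functional to which `e` applies.
    extend p (λ u → extend q (λ v → φ (u ∙ v)))      ≈⟨ at e _ ⟩
    extend p′ (λ u → extend q (λ v → φ (u ∙ v)))     ≈⟨ extend-product _∙_ p′ q φ ⟨
    extend (product _∙_ p′ q) φ                      ∎

  product-zeroʳ : (_∙_ : U → V → W) (p : Sum U) → product _∙_ p [] ≋ []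
  product-zeroʳ _∙_ []      = ≋.refl
  product-zeroʳ _∙_ (_ ∷ p) = product-zeroʳ _∙_ p

  product-distribʳ : (_∙_ : U → V → W) (p q : Sum U) (r : Sum V) →
    product _∙_ (p ++ q) r ≋ product _∙_ p r ++ product _∙_ q r
  product-distribʳ _∙_ p q r = mk≋ λ φ → begin
    extend (product _∙_ (p ++ q) r) φ
      ≈⟨ extend-product _∙_ (p ++ q) r φ ⟩
    extend (p ++ q) (λ u → extend r (λ v → φ (u ∙ v)))
      ≈⟨ extend-++ p q _ ⟩
    extend p (λ u → extend r (λ v → φ (u ∙ v))) + extend q (λ u → extend r (λ v → φ (u ∙ v)))
      ≈⟨ +-cong (extend-product _∙_ p r φ) (extend-product _∙_ q r φ) ⟨
    extend (product _∙_ p r) φ + extend (product _∙_ q r) φ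
      ≈⟨ extend-++ (product _∙_ p r) _ φ ⟨
    extend (product _∙_ p r ++ product _∙_ q r) φ ∎

  -- Four operations, since the factors of a mixed product may lie in different algebras.
  product-assoc : {T S : Set}
    (_∙₁_ : T → W → Z) (_∙₂_ : U → V → T) (_∙₃_ : U → S → Z) (_∙₄_ : V → W → S) →
    (∀ u v w → (u ∙₂ v) ∙₁ w ≡ u ∙₃ (v ∙₄ w)) → ∀ p q r →
    product _∙₁_ (product _∙₂_ p q) r ≋ product _∙₃_ p (product _∙₄_ q r)
  product-assoc _∙₁_ _∙₂_ _∙₃_ _∙₄_ assoc p q r = mk≋ λ φ → begin
    extend (product _∙₁_ (product _∙₂_ p q) r) φ
      ≈⟨ extend-product _∙₁_ (product _∙₂_ p q) r φ ⟩
    extend (product _∙₂_ p q) (λ t → extend r (λ w → φ (t ∙₁ w)))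
      ≈⟨ extend-product _∙₂_ p q _ ⟩
    extend p (λ u → extend q (λ v → extend r (λ w → φ ((u ∙₂ v) ∙₁ w))))
      ≈⟨ extend-cong p (λ u → extend-cong q (λ v → extend-cong r (λ w →
           reflexive (≡.cong φ (assoc u v w))))) ⟩
    extend p (λ u → extend q (λ v → extend r (λ w → φ (u ∙₃ (v ∙₄ w)))))
      ≈⟨ extend-cong p (λ u → extend-product _∙₄_ q r _) ⟨
    extend p (λ u → extend (product _∙₄_ q r) (λ s → φ (u ∙₃ s)))
      ≈⟨ extend-product _∙₃_ p (product _∙₄_ q r) φ ⟨
    extend (product _∙₃_ p (product _∙₄_ q r)) φ ∎

  monomial : W → Sum W
  monomial w = (1# , w) ∷ []

  extend-monomial : (w : W) (φ : W → k) → extend (monomial w) φ ≈ φ w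
  extend-monomial w φ = trans (+-identityʳ _) (*-identityˡ (φ w))

  product-identityˡ : (_∙_ : U → V → V) (e : U) → (∀ v → e ∙ v ≡ v) → ∀ p →
    product _∙_ (monomial e) p ≋ p
  product-identityˡ _∙_ e id p = mk≋ λ φ → begin
    extend (product _∙_ (monomial e) p) φ                   ≈⟨ extend-product _∙_ (monomial e) p φ ⟩
    extend (monomial e) (λ u → extend p (λ v → φ (u ∙ v)))
      ≈⟨ extend-monomial e (λ u → extend p (λ v → φ (u ∙ v))) ⟩
    extend p (λ v → φ (e ∙ v))  ≈⟨ extend-cong p (λ v → reflexive (≡.cong φ (id v))) ⟩
    extend p φ                  ∎

  product-identityʳ : (_∙_ : U → V → U) (e : V) → (∀ u → u ∙ e ≡ u) → ∀ p →
    product _∙_ p (monomial e) ≋ p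
  product-identityʳ _∙_ e id p = mk≋ λ φ → begin
    extend (product _∙_ p (monomial e)) φ                   ≈⟨ extend-product _∙_ p (monomial e) φ ⟩
    extend p (λ u → extend (monomial e) (λ v → φ (u ∙ v)))
      ≈⟨ extend-cong p (λ u → trans (extend-monomial e (λ v → φ (u ∙ v))) (reflexive (≡.cong φ (id u)))) ⟩
    extend p φ                                              ∎

  -- Linear maps induced by partial maps of bases.

  push : (V → Maybe W) → Sum V → Sum W
  push g = mapMaybe λ (a , v) → Maybe.map (a ,_) (g v)

  extend-push : (g : V → Maybe W) (p : Sum V) (φ : W → k) →
    extend (push g p) φ ≈ extend p (maybe φ 0# ∘ g)
  extend-push g []            φ = refl
  extend-push g ((a , v) ∷ p) φ with g v
  ... | just w  = +-congˡ (extend-push g p φ)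
  ... | nothing =
    trans (extend-push g p φ) (sym (trans (+-congʳ (zeroʳ a)) (+-identityˡ _)))

  push-cong : (g : V → Maybe W) {p q : Sum V} → p ≋ q → push g p ≋ push g q
  push-cong g {p} {q} e = mk≋ λ φ →
    trans (extend-push g p φ) (trans (at e _) (sym (extend-push g q φ)))

  -- If `g` acts on a word through its right factor only, so does its linear extension; words sent
  -- to `nothing` contribute zero on both sides.
  push-product : (g : W → Maybe Z) (h : V → Maybe U) {T : Set}
    (_∙_ : T → V → W) (_∘′_ : T → U → Z) →
    (∀ t v → g (t ∙ v) ≡ Maybe.map (t ∘′_) (h v)) → ∀ p q →
    push g (product _∙_ p q) ≋ product _∘′_ p (push h q)
  push-product g h _∙_ _∘′_ eq p q = mk≋ λ φ → begin
    extend (push g (product _∙_ p q)) φ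
      ≈⟨ extend-push g (product _∙_ p q) φ ⟩
    extend (product _∙_ p q) (maybe φ 0# ∘ g)
      ≈⟨ extend-product _∙_ p q _ ⟩
    extend p (λ t → extend q (λ v → maybe φ 0# (g (t ∙ v))))
      ≈⟨ extend-cong p (λ t → extend-cong q (λ v → reflexive
           (≡.trans (≡.cong (maybe φ 0#) (eq t v)) (maybe-map φ t (h v))))) ⟩
    extend p (λ t → extend q (λ v → maybe (λ u → φ (t ∘′ u)) 0# (h v)))
      ≈⟨ extend-cong p (λ t → extend-push h q _) ⟨
    extend p (λ t → extend (push h q) (λ u → φ (t ∘′ u)))
      ≈⟨ extend-product _∘′_ p (push h q) φ ⟨
    extend (product _∘′_ p (push h q)) φ ∎
    where
    maybe-map : ∀ φ t m → maybe φ 0# (Maybe.map (t ∘′_) m) ≡ maybe (λ u → φ (t ∘′ u)) 0# m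
    maybe-map φ t (just _) = ≡.refl
    maybe-map φ t nothing  = ≡.refl

  -- Coefficients determine a formal sum.

  module Coefficients {W : Set} (_≟_ : DecidableEquality W) (_∙_ : W → W → W) where
    open FreeAlg.Poly K _≟_ _∙_

    δ : W → W → k
    δ w u with u ≟ w
    ... | yes _ = 1#
    ... | no  _ = 0#

    coeff≈extend : ∀ p w → coeff p w ≈ extend p (δ w)
    coeff≈extend []            w = refl
    coeff≈extend ((a , u) ∷ p) w with u ≟ w
    ... | yes _ = +-cong (sym (*-identityʳ a)) (coeff≈extend p w)
    ... | no  _ = trans (coeff≈extend p w) (sym (trans (+-congʳ (zeroʳ a)) (+-identityˡ _)))

    mask : W → (W → k) → W → k
    mask u φ w with w ≟ u
    ... | yes _ = 0#
    ... | no  _ = φ w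

    -- All occurrences of `u` are gathered into one term; the remainder sees `u` with value zero.
    extend-mask : ∀ p u φ → extend p φ ≈ coeff p u * φ u + extend p (mask u φ)
    extend-mask []            u φ = sym (trans (+-identityʳ _) (zeroˡ _))
    extend-mask ((a , v) ∷ p) u φ with v ≟ u
    ... | yes ≡.refl = begin
      a * φ v + extend p φ
        ≈⟨ +-congˡ (extend-mask p u φ) ⟩
      a * φ v + (coeff p v * φ v + extend p (mask v φ))
        ≈⟨ +-assoc _ _ _ ⟨
      (a * φ v + coeff p v * φ v) + extend p (mask v φ)
        ≈⟨ +-cong (sym (distribʳ _ _ _)) (sym (trans (+-congʳ (zeroʳ a)) (+-identityˡ _))) ⟩
      (a + coeff p v) * φ v + (a * 0# + extend p (mask v φ)) ∎
    ... | no _ = begin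
      a * φ v + extend p φ
        ≈⟨ +-cong (+-identityˡ _) (sym (extend-mask p u φ)) ⟨
      (0# + a * φ v) + (coeff p u * φ u + extend p (mask u φ))
        ≈⟨ interchange _ _ _ _ ⟩
      (0# + coeff p u * φ u) + (a * φ v + extend p (mask u φ))
        ≈⟨ +-congʳ (+-identityˡ _) ⟩
      coeff p u * φ u + (a * φ v + extend p (mask u φ)) ∎

    -- The field has no decidable equality, so sums cannot be normalised; instead
    -- φ is cleared word by word along a list containing all words that occur.
    Covered : List W → (W → k) → P → Set (c ⊔ ℓ)
    Covered L φ = All λ m → proj₂ m ∈ L ⊎ φ (proj₂ m) ≈ 0#

    mask-covered : ∀ {u L φ p} → Covered (u ∷ L) φ p → Covered L (mask u φ) p
    mask-covered {u} {L} {φ} = All.map (λ {m} → step (proj₂ m))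
      where
      step : ∀ w → w ∈ u ∷ L ⊎ φ w ≈ 0# → w ∈ L ⊎ mask u φ w ≈ 0#
      step w h with w ≟ u | h
      ... | yes _   | _                 = inj₂ refl
      ... | no w≢u  | inj₁ (here w≡u)   = contradiction w≡u w≢u
      ... | no _    | inj₁ (there w∈L)  = inj₁ w∈L
      ... | no _    | inj₂ φw≈0         = inj₂ φw≈0

    extend-uncovered : ∀ {φ p} → Covered [] φ p → extend p φ ≈ 0#
    extend-uncovered []                = refl
    extend-uncovered (inj₂ φu≈0 ∷ hs)  =
      trans (+-cong (trans (*-congˡ φu≈0) (zeroʳ _)) (extend-uncovered hs)) (+-identityˡ 0#)

    -- Equal coefficients match the contributions of `u`; the masked remainder is covered by the
    -- shorter list. A repeated word does no harm, its value being zero by then.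
    extend-covered : ∀ L φ {p q} → Covered L φ p → Covered L φ q → p ≈P q →
      extend p φ ≈ extend q φ
    extend-covered []      φ hp hq e = trans (extend-uncovered hp) (sym (extend-uncovered hq))
    extend-covered (u ∷ L) φ {p} {q} hp hq e = begin
      extend p φ                                ≈⟨ extend-mask p u φ ⟩
      coeff p u * φ u + extend p (mask u φ)
        ≈⟨ +-cong (*-congʳ (e u))
                  (extend-covered L (mask u φ) (mask-covered hp) (mask-covered hq) e) ⟩
      coeff q u * φ u + extend q (mask u φ)     ≈⟨ extend-mask q u φ ⟨
      extend q φ                                ∎

    ≈P⇒≋ : ∀ p q → p ≈P q → p ≋ q
    ≈P⇒≋ p q e = mk≋ λ φ → extend-covered (map proj₂ p ++ map proj₂ q) φ
      (All.tabulate λ m∈p → inj₁ (∈-++⁺ˡ {ys = map proj₂ q} (∈-map⁺ proj₂ m∈p)))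
      (All.tabulate λ m∈q → inj₁ (∈-++⁺ʳ (map proj₂ p) (∈-map⁺ proj₂ m∈q)))
      e

    ≋⇒≈P : ∀ {p q} → p ≋ q → p ≈P q
    ≋⇒≈P {p} {q} e w = trans (coeff≈extend p w) (trans (at e (δ w)) (sym (coeff≈extend q w)))

    scaleMul≡map : ∀ m q → scaleMul m q ≡ map (bilinear _∙_ m) q
    scaleMul≡map m []      = ≡.refl
    scaleMul≡map m (_ ∷ q) = ≡.cong (_ ∷_) (scaleMul≡map m q)

    ·P≡product : ∀ p q → p ·P q ≡ product _∙_ p q
    ·P≡product []      q = ≡.refl
    ·P≡product (m ∷ p) q = ≡.cong₂ _++_ (scaleMul≡map m q) (·P≡product p q)

    ·P≈⇒≋ : ∀ p q r s → (p ·P q) ≈P (r ·P s) → product _∙_ p q ≋ product _∙_ r s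
    ·P≈⇒≋ p q r s rewrite ·P≡product p q | ·P≡product r s = ≈P⇒≋ _ _

    ≋⇒·P≈ : ∀ p q r s → product _∙_ p q ≋ product _∙_ r s → (p ·P q) ≈P (r ·P s)
    ≋⇒·P≈ p q r s rewrite ·P≡product p q | ·P≡product r s = ≋⇒≈P

-- Concatenation of words and erasure of their end letters.

module Words (m : ℕ) where
  W W⁺ : Set
  W  = List (Fin (suc m))
  W⁺ = Fin (suc m) × W

  infixr 5 _∙⁺_ _▸_ _◂_

  _∙⁺_ : W⁺ → W⁺ → W⁺
  (x , u) ∙⁺ (y , v) = x , (u ++ (y ∷ v))

  -- For non-empty `w` the projections expose a second letter without evaluating the recursive call,
  -- so that `strip` computes on the result.
  _▸_ : W → W⁺ → W⁺
  []      ▸ v = v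
  (y ∷ w) ▸ v = y , (proj₁ (w ▸ v) ∷ proj₂ (w ▸ v))

  _◂_ : W⁺ → W → W⁺
  (y , u) ◂ w = y , u ++ w

  x₀ : W⁺
  x₀ = zero , []

  tail⁺ : W⁺ → Maybe W⁺
  tail⁺ (y , [])    = nothing
  tail⁺ (y , z ∷ v) = just (z , v)

  -- Erases a final letter zero; words ending in another letter are sent to nothing.
  strip : W⁺ → Maybe W
  strip = λ (y , v) → go y v
    where
    go : Fin (suc m) → W → Maybe W
    go y       (z ∷ v) = Maybe.map (y ∷_) (go z v)
    go zero    []      = just []
    go (suc _) []      = nothing

  -- Unlike `strip`, it rejects `x₀` itself, so that results stay in the basis of the non-unital
  -- algebra.
  strip⁺ : W⁺ → Maybe W⁺
  strip⁺ (y , [])    = nothing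
  strip⁺ (y , z ∷ v) = Maybe.map (y ,_) (strip (z , v))

  ∙⁺≡▸ : ∀ y u v → (y , u) ∙⁺ v ≡ (y ∷ u) ▸ v
  ∙⁺≡▸ y []      v = ≡.refl
  ∙⁺≡▸ y (z ∷ u) v = ≡.cong (λ t → y , (proj₁ t ∷ proj₂ t)) (∙⁺≡▸ z u v)

  ++-▸ : ∀ u v w → (u ++ v) ▸ w ≡ u ▸ (v ▸ w)
  ++-▸ []      v w = ≡.refl
  ++-▸ (y ∷ u) v w = ≡.cong (λ t → y , (proj₁ t ∷ proj₂ t)) (++-▸ u v w)

  ◂-∙⁺ : ∀ u w v → (u ◂ w) ∙⁺ v ≡ u ∙⁺ (w ▸ v)
  ◂-∙⁺ (y , u) w v = ≡.trans (∙⁺≡▸ y (u ++ w) v)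
    (≡.trans (++-▸ (y ∷ u) w v) (≡.sym (∙⁺≡▸ y u (w ▸ v))))

  ◂-identityʳ : ∀ u → u ◂ [] ≡ u
  ◂-identityʳ (y , u) = ≡.cong (y ,_) (ListP.++-identityʳ u)

  -- The final letter of `w ▸ v` is that of `v`, so a prefix does not affect the erasure.
  strip-▸ : ∀ w v → strip (w ▸ v) ≡ Maybe.map (w ++_) (strip v)
  strip-▸ []      v = ≡.sym (MaybeP.map-id (strip v))
  strip-▸ (y ∷ w) v =
    ≡.trans (≡.cong (Maybe.map (y ∷_)) (strip-▸ w v)) (≡.sym (MaybeP.map-∘ (strip v)))

  strip⁺-∙⁺ : ∀ u v → strip⁺ (u ∙⁺ v) ≡ Maybe.map (u ◂_) (strip v)
  strip⁺-∙⁺ (y , u) v = ≡.trans (≡.cong strip⁺ (∙⁺≡▸ y u v))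
    (≡.trans (≡.cong (Maybe.map (y ,_)) (strip-▸ u v)) (≡.sym (MaybeP.map-∘ (strip v))))

-- The interpreting formulas.

-- Under u f = a, the equation u c = a z says that c = f z.
[_·_≐_·_] : ∀ {k} → Fin k → Fin k → Fin k → Fin k → Formula k
[ u · c ≐ a · z ] = (var u ⊗ var c) ≐ (var a ⊗ var z)

-- Left cancellability, rather than u ≠ 0, because the latter does not yield it
-- constructively over a field without decidable equality.
interpretation : InterpData
interpretation = record
  { dim   = 2
  ; dom   = ∀ᶠ (∀ᶠ ([ 2F · 1F ≐ 2F · 0F ] ⇒ᶠ (var 1F ≐ var 0F)))
            ∧ᶠ ∀ᶠ (∃ᶠ [ 2F · 0F ≐ 3F · 1F ])
  ; eqv   = ∀ᶠ (∃ᶠ ([ 2F · 0F ≐ 3F · 1F ] ∧ᶠ [ 4F · 0F ≐ 5F · 1F ]))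
  ; plus  = ∀ᶠ (∃ᶠ (∃ᶠ ([ 3F · 1F ≐ 4F · 2F ] ∧ᶠ ([ 5F · 0F ≐ 6F · 2F ]
            ∧ᶠ ((var 7F ⊗ (var 1F ⊕ var 0F)) ≐ (var 8F ⊗ var 2F))))))
  -- Innermost first: `0F` is f (g z), `1F` is g z, `2F` is z; then come the pairs encoding f, g and
  -- the candidate product.
  ; times = ∀ᶠ (∃ᶠ (∃ᶠ ([ 5F · 1F ≐ 6F · 2F ] ∧ᶠ ([ 3F · 0F ≐ 4F · 1F ]
            ∧ᶠ [ 7F · 0F ≐ 8F · 2F ]))))
  ; zeroF = var 1F ≐ zro
  ; oneF  = var 1F ≐ var 0F
  }

-- Cancellation, division by a generator, and coordinates.

module Correctness {c ℓ} (K : Field c ℓ) (m : ℕ) where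
  open FormalSums K
  open Words m
  open InterpData interpretation
  private
    module K = Field K
    module A = Struct¹ (FreeAlg.𝔸 K (suc m))
    module B = Struct⁰ (FreeAlg.𝔸⁰ K (suc m))
    module C = Coefficients (ListP.≡-dec (FinP._≟_ {suc m})) _++_
    module C⁺ = Coefficients (ProdP.≡-dec (FinP._≟_ {suc m}) (ListP.≡-dec FinP._≟_)) _∙⁺_

  infixl 7 _·_ _▷_ _◁_

  _·_ : Sum W⁺ → Sum W⁺ → Sum W⁺
  _·_ = product _∙⁺_

  _▷_ : Sum W → Sum W⁺ → Sum W⁺
  _▷_ = product _▸_

  _◁_ : Sum W⁺ → Sum W → Sum W⁺
  _◁_ = product _◂_

  x : Sum W⁺
  x = monomial x₀

  1ᴬ : Sum W
  1ᴬ = monomial []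

  LeftCancellable : Sum W⁺ → Set (c ⊔ ℓ)
  LeftCancellable u = ∀ {p q} → u · p ≋ u · q → p ≋ q

  ◁-· : ∀ u f z → (u ◁ f) · z ≋ u · (f ▷ z)
  ◁-· = product-assoc _∙⁺_ _◂_ _∙⁺_ _▸_ ◂-∙⁺

  strip-▷-x : ∀ f → push strip (f ▷ x) ≋ f
  strip-▷-x f = ≋.trans
    (push-product strip strip _▸_ _++_ strip-▸ f x)
    -- `push strip x` computes to the unit `1ᴬ`.
    (product-identityʳ _++_ [] ListP.++-identityʳ f)

  -- Erasing the final `x₀` undoes multiplication by `x`. A quantified formula read at `z = x` thus
  -- yields an equality in the unital algebra.
  ▷-x-injective : ∀ f g → f ▷ x ≋ g ▷ x → f ≋ g
  ▷-x-injective f g e =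
    ≋.trans (≋.sym (strip-▷-x f)) (≋.trans (push-cong strip e) (strip-▷-x g))

  -- Erasing the first letter recovers the right factor. This makes `x` a legitimate first component
  -- for every encoding.
  x-leftCancellable : LeftCancellable x
  x-leftCancellable {p} {q} e =
    ≋.trans (≋.sym (tail-x p)) (≋.trans (push-cong tail⁺ e) (tail-x q))
    where
    tail-x : ∀ p → push tail⁺ (x · p) ≋ p
    tail-x p = mk≋ λ φ → K.trans (extend-push tail⁺ (x · p) φ)
      (K.trans (extend-product _∙⁺_ x p _)
               (extend-monomial x₀ (λ u → extend p (λ v → maybe φ K.0# (tail⁺ (u ∙⁺ v))))))

  -- `strip⁺` acts on right factors only: it turns `u · b` into `u ◁ push strip b` and `a · x` into
  -- `a`. Words of `b` not ending in the letter of `x` drop out.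
  ◁-strip : ∀ u b a → u · b ≋ a · x → u ◁ push strip b ≋ a
  ◁-strip u b a e = begin
    u ◁ push strip b      ≈⟨ push-product strip⁺ strip _∙⁺_ _◂_ strip⁺-∙⁺ u b ⟨
    push strip⁺ (u · b)   ≈⟨ push-cong strip⁺ e ⟩
    push strip⁺ (a · x)   ≈⟨ push-product strip⁺ strip _∙⁺_ _◂_ strip⁺-∙⁺ a x ⟩
    a ◁ 1ᴬ                ≈⟨ product-identityʳ _◂_ [] ◂-identityʳ a ⟩
    a                     ∎
    where open SetoidReasoning (≋-setoid W⁺)

  -- Forgets how `decode` finds `f`; the formulas are verified from these two facts alone.
  record Encodes (a : Fin 2 → B.Carrier) (f : Sum W) : Set (c ⊔ ℓ) where
    field
      leftCancellable : LeftCancellable (a 0F)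
      represents      : a 0F ◁ f ≋ a 1F

    ·-▷ : ∀ z → a 0F · (f ▷ z) ≋ a 1F · z
    ·-▷ z = ≋.trans (≋.sym (◁-· (a 0F) f z)) (product-congʳ _∙⁺_ z represents)

    -- `f ▷ z` solves the same equation by `·-▷`, and `a 0F` cancels.
    quotient : ∀ {c z} → a 0F · c ≋ a 1F · z → c ≋ f ▷ z
    quotient {z = z} e = leftCancellable (≋.trans e (≋.sym (·-▷ z)))

    solves : ∀ {c z} → c ≋ f ▷ z → (a 0F B.· c) B.≈ (a 1F B.· z)
    solves {c} {z} e =
      C⁺.≋⇒·P≈ (a 0F) c (a 1F) z (≋.trans (product-congˡ _∙⁺_ (a 0F) e) (·-▷ z))

    solved : ∀ {c z} → (a 0F B.· c) B.≈ (a 1F B.· z) → c ≋ f ▷ z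
    solved {c} {z} e = quotient (C⁺.·P≈⇒≋ (a 0F) c (a 1F) z e)

  -- The witness at `z = x` comes from the proof of `dom`, but cancellability fixes it up to
  -- equality.
  decode : ∀ a → Sat (FreeAlg.𝔸⁰ K (suc m)) dom a → Sum W
  decode a (_ , divides) = push strip (proj₁ (divides x))

  encodes : ∀ a d → Encodes a (decode a d)
  encodes a (cancels , divides) = record
    { leftCancellable = λ {p} {q} e →
        C⁺.≈P⇒≋ p q (lower (cancels p q (lift (C⁺.≋⇒·P≈ (a 0F) p (a 0F) q e))))
    ; represents = ◁-strip (a 0F) (proj₁ (divides x)) (a 1F)
        (C⁺.·P≈⇒≋ (a 0F) (proj₁ (divides x)) (a 1F) x (lower (proj₂ (divides x))))
    }

  encode : ∀ f → Σ (Fin 2 → B.Carrier) λ a →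
    Σ (Sat (FreeAlg.𝔸⁰ K (suc m)) dom a) λ d → decode a d A.≈ f
  -- The pair is `x` and `x ◁ f`, with quotients `f ▷ z`; from the one at `z = x`, `strip` returns
  -- `f`.
  encode f = x VF.∷ (x ◁ f) VF.∷ VF.[]
    , ( (λ p q e → lift (C⁺.≋⇒≈P (x-leftCancellable (C⁺.·P≈⇒≋ x p x q (lower e)))))
      , (λ z → f ▷ z , lift (C⁺.≋⇒·P≈ x (f ▷ z) (x ◁ f) z (≋.sym (◁-· x f z)))))
    , C.≋⇒≈P (strip-▷-x f)

  -- Verification of the formulas.

  correct : Interprets interpretation (FreeAlg.𝔸 K (suc m)) (FreeAlg.𝔸⁰ K (suc m))
  correct = record
    { coord    = decode
    ; surj     = encode
    ; kernel   = λ a b da db → kernel (encodes a da) (encodes b db)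
    ; plus-ok  = λ a b e da db de → plus-ok (encodes a da) (encodes b db) (encodes e de)
    ; times-ok = λ a b e da db de → times-ok (encodes a da) (encodes b db) (encodes e de)
    ; zero-ok  = λ a da → zero-ok (encodes a da)
    ; one-ok   = λ a da → one-ok (encodes a da)
    }
    where
    open SetoidReasoning (≋-setoid W⁺)

    _⊨_ : ∀ {k} → Formula k → (Fin k → B.Carrier) → Set (c ⊔ ℓ)
    φ ⊨ ρ = Sat (FreeAlg.𝔸⁰ K (suc m)) φ ρ

    kernel : ∀ {a b f g} → Encodes a f → Encodes b g → (eqv ⊨ (a VF.++ b)) ⇔ (f A.≈ g)
    kernel {a} {b} {f} {g} F G = mk⇔ to from
      where
      module F = Encodes F
      module G = Encodes G

      to : eqv ⊨ (a VF.++ b) → f A.≈ g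
      to s with s x
      ... | c , lift p , lift q =
        C.≋⇒≈P (▷-x-injective f g (≋.trans (≋.sym (F.solved p)) (G.solved q)))

      from : f A.≈ g → eqv ⊨ (a VF.++ b)
      from f≈g z = f ▷ z , lift (F.solves ≋.refl)
                         , lift (G.solves (product-congʳ _▸_ z (C.≈P⇒≋ f g f≈g)))

    plus-ok : ∀ {a b e f g h} → Encodes a f → Encodes b g → Encodes e h →
      (plus ⊨ (a VF.++ (b VF.++ e))) ⇔ ((f A.+ g) A.≈ h)
    plus-ok {a} {b} {e} {f} {g} {h} F G H = mk⇔ to from
      where
      module F = Encodes F
      module G = Encodes G
      module H = Encodes H

      to : plus ⊨ (a VF.++ (b VF.++ e)) → (f A.+ g) A.≈ h
      to s with s x
      ... | p , q , lift p-eq , lift q-eq , lift sum-eq = C.≋⇒≈P (▷-x-injective (f ++ g) h (begin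
        (f ++ g) ▷ x        ≈⟨ product-distribʳ _▸_ f g x ⟩
        f ▷ x ++ g ▷ x      ≈⟨ ++-cong (F.solved p-eq) (G.solved q-eq) ⟨
        p ++ q              ≈⟨ H.solved sum-eq ⟩
        h ▷ x               ∎))

      from : (f A.+ g) A.≈ h → plus ⊨ (a VF.++ (b VF.++ e))
      from f+g≈h z = f ▷ z , g ▷ z , lift (F.solves ≋.refl) , lift (G.solves ≋.refl)
        , lift (H.solves (begin
          f ▷ z ++ g ▷ z      ≈⟨ product-distribʳ _▸_ f g z ⟨
          (f ++ g) ▷ z        ≈⟨ product-congʳ _▸_ z (C.≈P⇒≋ (f ++ g) h f+g≈h) ⟩
          h ▷ z               ∎))

    times-ok : ∀ {a b e f g h} → Encodes a f → Encodes b g → Encodes e h →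
      (times ⊨ (a VF.++ (b VF.++ e))) ⇔ ((f A.· g) A.≈ h)
    times-ok {a} {b} {e} {f} {g} {h} F G H = mk⇔ to from
      where
      module F = Encodes F
      module G = Encodes G
      module H = Encodes H

      -- Multiplication becomes composition of the maps sending `z` to `f ▷ z`, which is why `times`
      -- feeds the output of the second factor to the first.
      ·-▷-assoc : ∀ z → (f A.· g) ▷ z ≋ f ▷ (g ▷ z)
      ·-▷-assoc z = ≋.trans
        (product-congʳ _▸_ z (≋.reflexive (C.·P≡product f g)))
        (product-assoc _▸_ _++_ _▸_ _▸_ ++-▸ f g z)

      to : times ⊨ (a VF.++ (b VF.++ e)) → (f A.· g) A.≈ h
      to s with s x
      ... | q , r , lift q-eq , lift r-eq , lift prod-eq = C.≋⇒≈P (▷-x-injective (f A.· g) h (begin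
        (f A.· g) ▷ x       ≈⟨ ·-▷-assoc x ⟩
        f ▷ (g ▷ x)         ≈⟨ product-congˡ _▸_ f (G.solved q-eq) ⟨
        f ▷ q               ≈⟨ F.solved r-eq ⟨
        r                   ≈⟨ H.solved prod-eq ⟩
        h ▷ x               ∎))

      from : (f A.· g) A.≈ h → times ⊨ (a VF.++ (b VF.++ e))
      from fg≈h z = g ▷ z , f ▷ (g ▷ z) , lift (G.solves ≋.refl) , lift (F.solves ≋.refl)
        , lift (H.solves (begin
          f ▷ (g ▷ z)         ≈⟨ ·-▷-assoc z ⟨
          (f A.· g) ▷ z       ≈⟨ product-congʳ _▸_ z (C.≈P⇒≋ (f A.· g) h fg≈h) ⟩
          h ▷ z               ∎))

    zero-ok : ∀ {a f} → Encodes a f → (zeroF ⊨ a) ⇔ (f A.≈ A.0#)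
    zero-ok {a} {f} F = mk⇔ to from
      where
      module F = Encodes F

      to : zeroF ⊨ a → f A.≈ A.0#
      -- As `a 1F` vanishes, the empty sum solves `a 0F · c ≋ a 1F · x`, so it is `f ▷ x`.
      to (lift a≈0) = C.≋⇒≈P (▷-x-injective f [] (≋.sym (F.quotient {[]} (begin
        a 0F · []           ≈⟨ product-zeroʳ _∙⁺_ (a 0F) ⟩
        []                  ≈⟨ product-congʳ _∙⁺_ x (C⁺.≈P⇒≋ (a 1F) [] a≈0) ⟨
        a 1F · x            ∎))))

      from : f A.≈ A.0# → zeroF ⊨ a
      from f≈0 = lift (C⁺.≋⇒≈P (begin
        a 1F                ≈⟨ F.represents ⟨
        a 0F ◁ f            ≈⟨ product-congˡ _◂_ (a 0F) (C.≈P⇒≋ f [] f≈0) ⟩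
        a 0F ◁ []           ≈⟨ product-zeroʳ _◂_ (a 0F) ⟩
        []                  ∎))

    one-ok : ∀ {a f} → Encodes a f → (oneF ⊨ a) ⇔ (f A.≈ A.1#)
    one-ok {a} {f} F = mk⇔ to from
      where
      module F = Encodes F

      to : oneF ⊨ a → f A.≈ A.1#
      -- With both components equal, `x` is its own quotient, so `f ▷ x` is `x`.
      to (lift a≈u) = C.≋⇒≈P (▷-x-injective f 1ᴬ (begin
        f ▷ x     ≈⟨ F.quotient (product-congʳ _∙⁺_ x (≋.sym (C⁺.≈P⇒≋ (a 1F) (a 0F) a≈u))) ⟨
        x         ≈⟨ product-identityˡ _▸_ [] (λ _ → ≡.refl) x ⟨
        1ᴬ ▷ x    ∎))

      from : f A.≈ A.1# → oneF ⊨ a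
      from f≈1 = lift (C⁺.≋⇒≈P (begin
        a 1F                ≈⟨ F.represents ⟨
        a 0F ◁ f            ≈⟨ product-congˡ _◂_ (a 0F) (C.≈P⇒≋ f 1ᴬ f≈1) ⟩
        a 0F ◁ 1ᴬ           ≈⟨ product-identityʳ _◂_ [] ◂-identityʳ (a 0F) ⟩
        a 0F                ∎))

theorem9p1 : (n : ℕ) → .{{_ : NonZero n}} → UniformlyInterpretable n
theorem9p1 (suc m) = record
  -- The formulas are fixed before `K` and do not mention `m`, whence the uniformity; `suc m`
  -- supplies the generator `x`.
  { formulas = interpretation
  ; works    = λ K → Correctness.correct K m
  }
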